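{- Let $(L,\vee,\wedge,0,1)$ be a non-trivial complete lattice, let $T$ be a non-empty set, let $P,F\colon L^T\to L^T$ be tense operators on $L$ with time set $T$, and let $R$ denote the relation on $T$ induced by $P$ and $F$. Put $\bar T:=T_1\cup T\cup T_2$ where $T_1:=T\times\{1\}$ and $T_2:=T\times\{2\}$, and $$\bar R:=\{\big((s,1),s\big)\mid s\in T\}\cup R\cup\{\big(s,(s,2)\big)\mid s\in T\}\subseteq\bar T\times\bar T,$$ and let $\bar P,\bar F\colon L^{\bar T}\to L^{\bar T}$ denote the tense operators induced by the time frame $(\bar T,\bar R)$. For every $q\in L^T$ let $\bar q\in L^{\bar T}$ be defined by $$\bar q\big((s,1)\big):=P(q)(s),\quad \bar q(s):=q(s),\quad \bar q\big((s,2)\big):=F(q)(s)\quad\text{for all }s\in T.$$ Then $\bar R|T=R$, and $$\big(\bar P(\bar q)\big)|T=P(q)\quad\text{and}\quad\big(\bar F(\bar q)\big)|T=F(q)$$ for all $q\in L^T$.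
   Context: Tense operators on $L$ with time set $T$ (given abstractly, not from a time frame) are arbitrary maps $L^T\to L^T$, where $L^T$ is the set of all functions $T\to L$. Non-trivial means that $L$ has more than one element; $0$ and $1$ are its least and greatest elements. The sets $T_1$, $T$, $T_2$ are regarded as pairwise disjoint. The relation induced by $P$ and $F$ is $\{(s,t)\in T^2\mid q(s)\leq P(q)(t)\text{ and }q(t)\leq F(q)(s)\text{ for all }q\in L^T\}$. A time frame is a pair $(S,Q)$ of a non-empty set $S$ and a non-empty binary relation $Q$ on $S$. The tense operators $P_Q,F_Q\colon L^S\to L^S$ (playing the roles of $P$ and $F$) induced by $(S,Q)$ are defined, for $q\in L^S$ and $s\in S$, by $P_Q(q)(s):=\bigvee\{q(t)\mid t\mathrel Q s\}$ and $F_Q(q)(s):=\bigvee\{q(t)\mid s\mathrel Q t\}$, where the join of the empty set is $0$. Thus $\bar P=P_{\bar R}$ and $\bar F=F_{\bar R}$ for $S=\bar T$. $\bar R|T$ means $\bar R\cap T^2$, and $f|T$ for $f\in L^{\bar T}$ means the restriction of the function $f$ to $T$. -}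

module Defs where

open import Level using (Level; suc; _⊔_)
open import Data.Product using (∃; ∃₂; _×_; _,_)
open import Function.Bundles using (Func; _⟨$⟩_)
open import Function.Indexed.Relation.Binary.Equality using (≡-setoid)
open import Relation.Binary.Bundles using (Setoid)
open import Relation.Binary.Core using (Rel)
open import Relation.Binary.Indexed.Heterogeneous.Construct.Trivial using (indexedSetoid)
open import Relation.Binary.Lattice.Bundles using (BoundedLattice)
open import Relation.Nullary using (¬_)
open import Relation.Unary using (Pred; _∈_; _⊆_)

-- Subsets of a lattice are predicates.  As Agda is predicative, the universe
-- level p of the subsets that have joins and meets must be recorded.
record CompleteLattice (c ℓ₁ ℓ₂ p : Level) : Set (suc (c ⊔ ℓ₁ ⊔ ℓ₂ ⊔ p)) where
  field
    boundedLattice : BoundedLattice c ℓ₁ ℓ₂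

  open BoundedLattice boundedLattice public

  field
    ⋁          : Pred Carrier p → Carrier
    ⋁-upper    : ∀ A {x} → x ∈ A → x ≤ ⋁ A
    ⋁-least    : ∀ A z → (∀ {x} → x ∈ A → x ≤ z) → ⋁ A ≤ z
    ⋀          : Pred Carrier p → Carrier
    ⋀-lower    : ∀ A {x} → x ∈ A → ⋀ A ≤ x
    ⋀-greatest : ∀ A z → (∀ {x} → x ∈ A → z ≤ x) → z ≤ ⋀ A

record TimeFrame (s r : Level) : Set (suc (s ⊔ r)) where
  field
    Time          : Set s
    Q             : Rel Time r
    time-nonempty : Time
    Q-nonempty    : ∃₂ Q

data Extended {t} (T : Set t) : Set t where
  ⟨_,1⟩ : T → Extended T
  mid   : T → Extended T
  ⟨_,2⟩ : T → Extended T

data ExtendedRel {t r} {T : Set t} (R : Rel T r) : Rel (Extended T) (t ⊔ r) where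
  first  : ∀ s → ExtendedRel R ⟨ s ,1⟩ (mid s)
  middle : ∀ {s u} → R s u → ExtendedRel R (mid s) (mid u)
  last   : ∀ s → ExtendedRel R (mid s) ⟨ s ,2⟩

-- The frame (T̄ , R̄); the point t₀ witnesses that T is non-empty.
extendedFrame : ∀ {t r} {T : Set t} → T → Rel T r → TimeFrame t (t ⊔ r)
extendedFrame {T = T} t₀ R = record
  { Time          = Extended T
  ; Q             = ExtendedRel R
  ; time-nonempty = mid t₀
  ; Q-nonempty    = ⟨ t₀ ,1⟩ , mid t₀ , first t₀
  }

module _ {c ℓ₁ ℓ₂ p} (L : CompleteLattice c ℓ₁ ℓ₂ p) where
  open CompleteLattice L

  NonTrivial : Set (c ⊔ ℓ₁)
  NonTrivial = ∃₂ λ x y → ¬ (x ≈ y)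

  -- L^T, whose elements are all functions T → L, compared pointwise.
  Power : ∀ {t} → Set t → Setoid (c ⊔ t) (ℓ₁ ⊔ t)
  Power T = ≡-setoid T (indexedSetoid setoid)

  -- An arbitrary map L^T → L^T: being a map, it preserves the equality of L^T.
  TenseOperator : ∀ {t} → Set t → Set (c ⊔ ℓ₁ ⊔ t)
  TenseOperator T = Func (Power T) (Power T)

  module _ {t} {T : Set t} (P F : TenseOperator T) where

    inducedRelation : Rel T (c ⊔ ℓ₂ ⊔ t)
    inducedRelation s u =
      ∀ (q : T → Carrier) → q s ≤ (P ⟨$⟩ q) u × q u ≤ (F ⟨$⟩ q) s

    extend : (T → Carrier) → (Extended T → Carrier)
    extend q ⟨ s ,1⟩ = (P ⟨$⟩ q) s
    extend q (mid s) = q s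
    extend q ⟨ s ,2⟩ = (F ⟨$⟩ q) s

module _ {c ℓ₁ ℓ₂ s r} (L : CompleteLattice c ℓ₁ ℓ₂ (ℓ₁ ⊔ s ⊔ r))
         (frame : TimeFrame s r) where
  open CompleteLattice L
  open TimeFrame frame

  -- { q(t) ∣ t ∈ I }
  values : Pred Time r → (Time → Carrier) → Pred Carrier (ℓ₁ ⊔ s ⊔ r)
  values I q x = ∃ λ t → t ∈ I × x ≈ q t

  ⋁-values-cong : ∀ I {q q′ : Time → Carrier} → (∀ t → q t ≈ q′ t) →
                  ⋁ (values I q) ≈ ⋁ (values I q′)
  ⋁-values-cong I q≈q′ = antisym (⋁-mono (values-⊆ q≈q′))
                                 (⋁-mono (values-⊆ λ t → Eq.sym (q≈q′ t)))
    where
    values-⊆ : ∀ {f g : Time → Carrier} → (∀ t → f t ≈ g t) → values I f ⊆ values I g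
    values-⊆ f≈g (t , t∈I , x≈ft) = t , t∈I , Eq.trans x≈ft (f≈g t)

    ⋁-mono : ∀ {A B : Pred Carrier (ℓ₁ ⊔ s ⊔ r)} → A ⊆ B → ⋁ A ≤ ⋁ B
    ⋁-mono {A} {B} A⊆B = ⋁-least A (⋁ B) λ x∈A → ⋁-upper B (A⊆B x∈A)

  inducedP : TenseOperator L Time
  inducedP = record
    { to   = λ q u → ⋁ (values (λ t → Q t u) q)
    ; cong = λ q≈q′ u → ⋁-values-cong (λ t → Q t u) q≈q′
    }

  inducedF : TenseOperator L Time
  inducedF = record
    { to   = λ q u → ⋁ (values (λ t → Q u t) q)
    ; cong = λ q≈q′ u → ⋁-values-cong (λ t → Q u t) q≈q′
    }

{-# OPTIONS --safe #-}
-- The new predecessor (u , 1) of u carries the value P(q)(u), and every other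
-- predecessor s of u has s R u, hence q(s) ≤ P(q)(u) by the definition of the
-- induced relation.  So the join defining P̄(q̄)(u) is a maximum, attained at
-- (u , 1); dually, the one defining F̄(q̄)(u) is attained at (u , 2).
module Submission where

open import Defs
open import Level using (Level; _⊔_)
open import Data.Product using (_×_; _,_; proj₁; proj₂)
open import Function.Base using (_∘_; _on_)
open import Function.Bundles using (_⟨$⟩_)
open import Relation.Binary.Bundles using (Setoid)
open import Relation.Binary.Core using (_⇔_)
open import Relation.Unary using (Pred; _∈_)

module _ {c ℓ₁ ℓ₂ s r} (L : CompleteLattice c ℓ₁ ℓ₂ (ℓ₁ ⊔ s ⊔ r))
         (frame : TimeFrame s r) where
  open CompleteLattice L
  open TimeFrame frame

  -- `q m` is one of the joined values, hence below the join, and it bounds all of them. As `I` is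
  -- arbitrary, this serves predecessors and successors alike.
  ⋁-values-max : (I : Pred Time r) (q : Time → Carrier) {m : Time} → m ∈ I →
                 (∀ {t} → t ∈ I → q t ≤ q m) → ⋁ (values L frame I q) ≈ q m
  ⋁-values-max I q {m} m∈I q≤qm = antisym
    (⋁-least _ (q m) λ (t , t∈I , x≈qt) → trans (reflexive x≈qt) (q≤qm t∈I))
    (⋁-upper _ (m , m∈I , Eq.refl))

theorem5p8 :
    ∀ {c ℓ₁ ℓ₂ t : Level} (L : CompleteLattice c ℓ₁ ℓ₂ (c ⊔ ℓ₁ ⊔ ℓ₂ ⊔ t)) →
    NonTrivial L →
    (T : Set t) (t₀ : T) (P F : TenseOperator L T) →
    let R     = inducedRelation L P F
        frame = extendedFrame t₀ R
        R̄     = TimeFrame.Q frame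
        P̄     = inducedP L frame
        F̄     = inducedF L frame
        _≈ᵀ_  = Setoid._≈_ (Power L T)
    in ((R̄ on mid) ⇔ R)
       × (∀ (q : T → CompleteLattice.Carrier L) →
            let q̄ = extend L P F q
            in (((P̄ ⟨$⟩ q̄) ∘ mid) ≈ᵀ (P ⟨$⟩ q))
               × (((F̄ ⟨$⟩ q̄) ∘ mid) ≈ᵀ (F ⟨$⟩ q)))
-- Distinct constructors keep the three copies of `T` disjoint, so only `middle` relates two `mid`
-- points.
theorem5p8 L _ T t₀ P F = ((λ { (middle sRu) → sRu }) , middle) , λ q →
    (λ u → ⋁-values-max L frame (λ t → ExtendedRel R t (mid u)) (extend L P F q) (first u)
      -- `first` leaves only the maximiser `⟨ u ,1⟩` itself; no `last` arrow ends at a `mid` point.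
      λ { (first _) → refl ; (middle sRu) → proj₁ (sRu q) })
  , (λ u → ⋁-values-max L frame (ExtendedRel R (mid u)) (extend L P F q) (last u)
      λ { (middle uRs) → proj₂ (uRs q) ; (last _) → refl })
  where
  open CompleteLattice L using (refl)
  R     = inducedRelation L P F
  frame = extendedFrame t₀ R
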